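{- For all integers $d\ge1$ and $n\ge1$, $$\widetilde{\mathsf{p}}_d(n)\le \widetilde{\mathsf{m}}_d(dn-d+1).$$ In particular, $$\mathsf{p}_d(n)\le (dn-d+1)\,\mathsf{m}_d(dn-d+1).$$
   Context: A $d$-dimensional partition is an array $\pi = (\pi_{i_1,\ldots,i_d})_{i_1,\ldots,i_d\ge 1}$ of nonnegative integers with only finitely many nonzero entries such that $\pi_{i_1,\ldots,i_d}\ge \pi_{j_1,\ldots,j_d}$ whenever $i_1\le j_1,\ldots,i_d\le j_d$. Its volume is $|\pi| = \sum_{i_1,\ldots,i_d}\pi_{i_1,\ldots,i_d}$. $\mathsf{p}_d(n)$ denotes the number of $d$-dimensional partitions of volume $n$, and $\widetilde{\mathsf{p}}_d(n)=\sum_{0\le i\le n}\mathsf{p}_d(i)$ the number of those of volume at most $n$. MacMahon's numbers $\mathsf{m}_d(n)$ are defined by the formal power series identity $$\sum_{n\ge0}\mathsf{m}_d(n)\,x^n=\prod_{n\ge1}(1-x^n)^{ -\binom{n+d-2}{d-1}},$$ and $\widetilde{\mathsf{m}}_d(n)=\sum_{0\le i\le n}\mathsf{m}_d(i)$. -}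

module Defs where

open import Data.Fin as Fin using (Fin; toℕ; fromℕ<; finToFun; funToFin; combine)
open import Data.Fin.Properties
  using (toℕ-fromℕ<; toℕ-injective; finToFun-funToFin; funToFin-finToFin)
open import Data.List as List
  using (List; []; _∷_; _++_; [_]; map; filter; length; upTo; allFin; lookup; applyUpTo;
         cartesianProductWith)
open import Data.List.Membership.Propositional using (_∈_)
open import Data.List.Membership.Propositional.Properties
  using (∈-∃++; ∈-lookup; ∈-filter⁺; ∈-filter⁻; ∈-allFin; ∈-upTo⁺; ∈-upTo⁻; ∈-map⁻; ∈-++⁻; ∈-++⁺ˡ;
         ∈-++⁺ʳ; ∈-cartesianProductWith⁺; ∈-cartesianProductWith⁻)
open import Data.List.Properties using (length-map; length-upTo; map-applyUpTo; map-cong-local)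
open import Data.List.Relation.Binary.Permutation.Propositional.Properties using (shift; map⁺)
open import Data.List.Relation.Unary.All as All using (All; []; _∷_)
open import Data.List.Relation.Unary.Any as Any using (here; there)
open import Data.List.Relation.Unary.Any.Properties using (lookup-index)
open import Data.List.Relation.Unary.AllPairs using ([]; _∷_)
open import Data.List.Relation.Unary.Unique.Propositional using (Unique)
import Data.List.Relation.Unary.Unique.Propositional.Properties as Unique
open import Data.Nat
open import Data.Nat.Combinatorics using (_C_)
open import Data.Nat.Divisibility using (_∣_; _∣?_; ∣m+n∣m⇒∣n; ∣m∣n⇒∣m+n; ∣-refl; ∣⇒≤; _∣0)
open import Data.Nat.ListAction using (sum)
open import Data.Nat.ListAction.Properties using (sum-↭)
open import Data.Nat.Properties
open import Data.Product using (Σ; ∃; _×_; _,_; proj₁; proj₂)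
open import Data.Sum using (inj₁; inj₂)
open import Data.Vec as Vec using (Vec; []; _∷_; _[_]≔_)
open import Data.Vec.Properties using (lookup∘update; ≡-dec)
open import Data.Vec.Relation.Binary.Pointwise.Inductive as Pointwise using (Pointwise; []; _∷_)
open import Function using (_∘_)
open import Function.Bundles using (Bijection)
open import Level using (0ℓ)
open import Relation.Binary using (Setoid)
open import Relation.Binary.PropositionalEquality hiding ([_])
open import Relation.Nullary using (¬_; Dec; yes; no; contradiction)
open import Relation.Nullary.Decidable using (_×-dec_; _→-dec_)

private
  variable
    d n : ℕ

-- Σ_{0 ≤ i ≤ n} f i
sumUpTo : (ℕ → ℕ) → ℕ → ℕ
sumUpTo f n = sum (map f (upTo (suc n)))

------------------------------------------------------------------------
-- Multidimensional partitions

-- The coordinates of a position start at 0 rather than at 1.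
Position : ℕ → Set
Position d = Vec ℕ d

-- `support` is any repetition-free list containing all the positions of
-- nonzero entries; it may also contain positions of zero entries, which
-- do not affect the volume (`volume-cong` below).
record Partition (d : ℕ) : Set where
  field
    entry    : Position d → ℕ
    antitone : ∀ {i j} → Pointwise _≤_ i j → entry j ≤ entry i
    support  : List (Position d)
    unique   : Unique support
    finite   : ∀ {i} → entry i ≢ 0 → i ∈ support

  volume : ℕ
  volume = sum (map entry support)

open Partition

-- Two partitions are equal when their entries are; `support` is only a
-- witness of finiteness.
partitions : (d n : ℕ) → Setoid 0ℓ 0ℓ
partitions d n = record
  { Carrier       = Σ (Partition d) λ π → volume π ≡ n
  ; _≈_           = λ π ρ → ∀ i → entry (proj₁ π) i ≡ entry (proj₁ ρ) i
  ; isEquivalence = record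
    { refl  = λ _ → refl
    ; sym   = λ e i → sym (e i)
    ; trans = λ e f i → trans (e i) (f i)
    }
  }

HasCardinality : Setoid 0ℓ 0ℓ → ℕ → Set
HasCardinality S k = Bijection (setoid (Fin k)) S

------------------------------------------------------------------------
-- There are finitely many partitions of each volume

sum-mono : ∀ {A : Set} (f : A → ℕ) {xs ys : List A} → Unique xs →
           (∀ {x} → x ∈ xs → f x ≢ 0 → x ∈ ys) → sum (map f xs) ≤ sum (map f ys)
sum-mono f {[]} _ _ = z≤n
sum-mono f {x ∷ xs} {ys} (x∉xs ∷ uxs) sub with f x in eq
... | zero = sum-mono f uxs (sub ∘ there)
... | suc m with ∈-∃++ (sub (here refl) (λ z → 0≢1+n (trans (sym z) eq)))
...   | ps , qs , refl = begin
  suc m + sum (map f xs)           ≤⟨ +-monoʳ-≤ (suc m) (sum-mono f uxs sub′) ⟩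
  suc m + sum (map f (ps ++ qs))   ≡⟨ cong (_+ sum (map f (ps ++ qs))) eq ⟨
  sum (map f (x ∷ ps ++ qs))       ≡⟨ sum-↭ (map⁺ f (shift x ps qs)) ⟨
  sum (map f (ps ++ [ x ] ++ qs))  ∎
  where
  open ≤-Reasoning
  sub′ : ∀ {y} → y ∈ xs → f y ≢ 0 → y ∈ ps ++ qs
  sub′ y∈xs fy≢0 with ∈-++⁻ ps (sub (there y∈xs) fy≢0)
  ... | inj₁ y∈ps = ∈-++⁺ˡ y∈ps
  ... | inj₂ (here refl) = contradiction refl (All.lookup x∉xs y∈xs)
  ... | inj₂ (there y∈qs) = ∈-++⁺ʳ ps y∈qs

volume-cong : (π ρ : Partition d) → (∀ i → entry π i ≡ entry ρ i) → volume π ≡ volume ρ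
volume-cong π ρ e = ≤-antisym (half π ρ e) (half ρ π (sym ∘ e))
  where
  half : (π ρ : Partition d) → (∀ i → entry π i ≡ entry ρ i) → volume π ≤ volume ρ
  half π ρ e = subst (λ s → volume π ≤ s)
    (cong sum (map-cong-local {xs = support ρ} (All.tabulate λ {i} _ → e i)))
    (sum-mono (entry π) (unique π) λ {i} _ nz → finite ρ (nz ∘ trans (e i)))

length≤sum : ∀ {A : Set} (f : A → ℕ) (xs : List A) → (∀ {x} → x ∈ xs → f x ≢ 0) →
             length xs ≤ sum (map f xs)
length≤sum f [] _ = z≤n
length≤sum f (x ∷ xs) nz =
  +-mono-≤ (n≢0⇒n>0 (nz (here refl))) (length≤sum f xs (nz ∘ there))

lookup-injective : ∀ {A : Set} {xs : List A} → Unique xs → ∀ {a b} →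
                   lookup xs a ≡ lookup xs b → a ≡ b
lookup-injective {xs = _ ∷ _} _ {Fin.zero} {Fin.zero} _ = refl
lookup-injective {xs = _ ∷ xs} (x∉ ∷ _) {Fin.zero} {Fin.suc b} e =
  contradiction e (All.lookup x∉ (∈-lookup b))
lookup-injective {xs = _ ∷ xs} (x∉ ∷ _) {Fin.suc a} {Fin.zero} e =
  contradiction (sym e) (All.lookup x∉ (∈-lookup a))
lookup-injective {xs = _ ∷ _} (_ ∷ u) {Fin.suc a} {Fin.suc b} e =
  cong Fin.suc (lookup-injective u e)

funToFin-cong : ∀ {m n} {f g : Fin m → Fin n} → (∀ i → f i ≡ g i) → funToFin f ≡ funToFin g
funToFin-cong {zero}  _ = refl
funToFin-cong {suc m} e = cong₂ combine (e Fin.zero) (funToFin-cong (e ∘ Fin.suc))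

box : (d n : ℕ) → List (Position d)
box zero    n = [ [] ]
box (suc d) n = cartesianProductWith _∷_ (upTo n) (box d n)

box-unique : ∀ d n → Unique (box d n)
box-unique zero    n = [] ∷ []
box-unique (suc d) n =
  Unique.cartesianProductWith⁺ _∷_ (λ { refl → refl , refl }) (Unique.upTo⁺ n) (box-unique d n)

∈-box : (i : Position d) → (∀ j → Vec.lookup i j < n) → i ∈ box d n
∈-box []      _ = here refl
∈-box (a ∷ i) h =
  ∈-cartesianProductWith⁺ _∷_ (∈-upTo⁺ (h Fin.zero)) (∈-box i (h ∘ Fin.suc))

update-≤ : (i : Position d) (j : Fin d) {k : ℕ} → k ≤ Vec.lookup i j →
           Pointwise _≤_ (i [ j ]≔ k) i
update-≤ (_ ∷ i) Fin.zero    le = le ∷ Pointwise.refl ≤-refl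
update-≤ (_ ∷ i) (Fin.suc j) le = ≤-refl ∷ update-≤ i j le

module _ (π : Partition d) where

  entry≤volume : ∀ i → entry π i ≤ volume π
  entry≤volume i = subst (_≤ volume π) (+-identityʳ _)
    (sum-mono (entry π) {[ i ]} ([] ∷ []) λ { (here refl) → finite π })

  nonzero⇒lookup<volume : ∀ {i} → entry π i ≢ 0 → ∀ j → Vec.lookup i j < volume π
  nonzero⇒lookup<volume {i} nz j = begin
    suc m                                                 ≡⟨ trans (length-map _ (upTo (suc m))) (length-upTo (suc m)) ⟨
    length line                                           ≤⟨ length≤sum (entry π) line line-nonzero ⟩
    sum (map (entry π) line)                              ≤⟨ sum-mono (entry π) line-unique (λ _ → finite π) ⟩
    volume π                                              ∎
    where
    open ≤-Reasoning
    m : ℕ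
    m = Vec.lookup i j
    line : List (Position d)
    line = map (i [ j ]≔_) (upTo (suc m))
    line-unique : Unique line
    line-unique = Unique.map⁺
      (λ {x} {y} e → trans (sym (lookup∘update j i x))
                           (trans (cong (λ v → Vec.lookup v j) e) (lookup∘update j i y)))
      (Unique.upTo⁺ (suc m))
    line-nonzero : ∀ {x} → x ∈ line → entry π x ≢ 0
    line-nonzero x∈ z with ∈-map⁻ (i [ j ]≔_) x∈
    ... | k , k∈ , refl = nz (n≤0⇒n≡0 (subst (entry π i ≤_) z
            (antitone π (update-≤ i j (≤-pred (∈-upTo⁻ k∈))))))

  nonzero⇒∈box : ∀ {i} → entry π i ≢ 0 → i ∈ box d (volume π)
  nonzero⇒∈box nz = ∈-box _ (nonzero⇒lookup<volume nz)

-- Partitions of volume n are encoded by their restrictions to `box d n`,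
-- which are maps into Fin (suc n).
module Enumerate (d n : ℕ) where

  B : List (Position d)
  B = box d n

  Code : Set
  Code = Fin (suc n ^ length B)

  open import Data.List.Membership.DecPropositional {A = Position d} (≡-dec _≟_) using (_∈?_)

  value : Code → Position d → ℕ
  value c i with i ∈? B
  ... | yes i∈B = toℕ (finToFun {suc n} {length B} c (Any.index i∈B))
  ... | no  _   = 0

  value-lookup : ∀ c k → value c (lookup B k) ≡ toℕ (finToFun {suc n} {length B} c k)
  value-lookup c k with lookup B k ∈? B
  ... | yes p = cong (toℕ ∘ finToFun {suc n} {length B} c)
                  (lookup-injective (box-unique d n) (sym (lookup-index p)))
  ... | no ¬p = contradiction (∈-lookup k) ¬p

  value-support : ∀ c {i} → value c i ≢ 0 → i ∈ B
  value-support c {i} nz with i ∈? B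
  ... | yes p = p
  ... | no  _ = contradiction refl nz

  value-injective : ∀ c c′ → (∀ i → value c i ≡ value c′ i) → c ≡ c′
  value-injective c c′ e = begin
    c                                               ≡⟨ funToFin-finToFin {length B} {suc n} c ⟨
    funToFin (finToFun {suc n} {length B} c)        ≡⟨ funToFin-cong (λ k → toℕ-injective
                                                         (trans (sym (value-lookup c k))
                                                         (trans (e _) (value-lookup c′ k)))) ⟩
    funToFin (finToFun {suc n} {length B} c′)       ≡⟨ funToFin-finToFin {length B} {suc n} c′ ⟩
    c′                                              ∎
    where open ≡-Reasoning

  Valid : Code → Set
  Valid c = All (λ i → All (λ j → Pointwise _≤_ i j → value c j ≤ value c i) B) B
          × sum (map (value c) B) ≡ n

  valid? : ∀ c → Dec (Valid c)
  valid? c =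
    All.all? (λ i → All.all? (λ j → Pointwise.decidable _≤?_ i j →-dec (value c j ≤? value c i)) B) B
    ×-dec (sum (map (value c) B) ≟ n)

  box-closed : ∀ {i j : Position d} → Pointwise _≤_ i j → j ∈ B → i ∈ B
  box-closed {i} le j∈B = ∈-box i λ a → ≤-<-trans (Pointwise.lookup le a) (∈-box⁻ j∈B a)
    where
    ∈-box⁻ : ∀ {d n} {i : Position d} → i ∈ box d n → ∀ a → Vec.lookup i a < n
    ∈-box⁻ {suc d} {n} i∈ a with ∈-cartesianProductWith⁻ _∷_ (upTo n) (box d n) i∈
    ∈-box⁻ {suc d} {n} i∈ Fin.zero    | _ , _ , x∈ , _ , refl = ∈-upTo⁻ x∈
    ∈-box⁻ {suc d} {n} i∈ (Fin.suc a) | _ , _ , _ , y∈ , refl = ∈-box⁻ y∈ a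

  decode : ∀ c → Valid c → Partition d
  decode c (anti , _) = record
    { entry    = value c
    ; antitone = value-antitone
    ; support  = B
    ; unique   = box-unique d n
    ; finite   = value-support c
    }
    where
    value-antitone : ∀ {i j} → Pointwise _≤_ i j → value c j ≤ value c i
    value-antitone {i} {j} le with value c j ≟ 0
    ... | yes z = subst (_≤ value c i) (sym z) z≤n
    ... | no nz = All.lookup (All.lookup anti (box-closed le j∈B)) j∈B le
      where
      j∈B : j ∈ B
      j∈B = value-support c nz

  encode : (π : Partition d) → volume π ≡ n → Code
  encode π v = funToFin {length B} {suc n}
    (λ k → fromℕ< (s≤s (subst (entry π (lookup B k) ≤_) v (entry≤volume π _))))

  value-encode : ∀ π v i → value (encode π v) i ≡ entry π i
  value-encode π v i with i ∈? B
  ... | yes p = trans (cong toℕ (finToFun-funToFin {length B} {suc n} _ (Any.index p)))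
                  (trans (toℕ-fromℕ< _) (cong (entry π) (sym (lookup-index p))))
  ... | no ¬p with entry π i ≟ 0
  ...   | yes z = sym z
  ...   | no nz = contradiction (subst (λ k → i ∈ box d k) v (nonzero⇒∈box π nz)) ¬p

  valid-encode : ∀ π v → Valid (encode π v)
  valid-encode π v =
    All.tabulate (λ {i} _ → All.tabulate λ {j} _ le →
      subst₂ _≤_ (sym (value-encode π v j)) (sym (value-encode π v i)) (antitone π le))
    , (begin
      sum (map (value (encode π v)) B)  ≡⟨ cong sum (map-cong-local {xs = B} (All.tabulate λ {i} _ → value-encode π v i)) ⟩
      sum (map (entry π) B)             ≡⟨ ≤-antisym (sum-mono (entry π) (box-unique d n) (λ _ → finite π))
                                             (sum-mono (entry π) (unique π) (λ {i} _ nz →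
                                               subst (λ k → i ∈ box d k) v (nonzero⇒∈box π nz))) ⟩
      volume π                          ≡⟨ v ⟩
      n                                 ∎)
    where open ≡-Reasoning

  codes : List Code
  codes = filter valid? (allFin _)

  codes-unique : Unique codes
  codes-unique = Unique.filter⁺ valid? (Unique.allFin⁺ _)

  codes-valid : ∀ a → Valid (lookup codes a)
  codes-valid a = proj₂ (∈-filter⁻ valid? {xs = allFin _} (∈-lookup a))

  bijection : HasCardinality (partitions d n) (length codes)
  bijection = record
    { to        = λ a → decode _ (codes-valid a) , proj₂ (codes-valid a)
    ; cong      = λ { refl _ → refl }
    ; bijective = (λ e → lookup-injective codes-unique (value-injective _ _ e))
                , surj
    }
    where
    surj : (π : Setoid.Carrier (partitions d n)) → ∃ λ a → ∀ {b} → b ≡ a →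
           ∀ i → value (lookup codes b) i ≡ entry (proj₁ π) i
    surj (π , v) = Any.index c∈ , λ { refl i →
      trans (cong (λ c → value c i) (sym (lookup-index c∈))) (value-encode π v i) }
      where
      c∈ : encode π v ∈ codes
      c∈ = ∈-filter⁺ valid? (∈-allFin _) (valid-encode π v)

partitions-finite : ∀ d n → ∃ (HasCardinality (partitions d n))
partitions-finite d n = _ , Enumerate.bijection d n

p : ℕ → ℕ → ℕ
p d n = proj₁ (partitions-finite d n)

p̃ : ℕ → ℕ → ℕ
p̃ d = sumUpTo (p d)

------------------------------------------------------------------------
-- MacMahon's numbers

-- A formal power series, as the sequence of its coefficients.
Series : Set
Series = ℕ → ℕ

infixl 7 _⊛_
_⊛_ : Series → Series → Series
(f ⊛ g) n = sumUpTo (λ i → f i * g (n ∸ i)) n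

one : Series
one zero    = 1
one (suc _) = 0

infixr 8 _↑_
_↑_ : Series → ℕ → Series
f ↑ zero  = one
f ↑ suc c = f ⊛ f ↑ c

-- (1 - x^k)⁻¹ = Σ_{j ≥ 0} x^(j k), for k ≥ 1 (`geometric-inverse` below)
geometric : ℕ → Series
geometric k n with k ∣? n
... | yes _ = 1
... | no  _ = 0

-- ∏_{1 ≤ k ≤ N} (1 - x^k)^(- binom(k+d-2, d-1)), for d ≥ 1
macMahonProduct : (d N : ℕ) → Series
macMahonProduct d zero    = one
macMahonProduct d (suc N) =
  macMahonProduct d N ⊛ geometric (suc N) ↑ ((suc N + d ∸ 2) C (d ∸ 1))

-- The factors with k > n do not affect the coefficient of x^n in the
-- infinite product (`m-stable` below).
m : ℕ → ℕ → ℕ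
m d n = macMahonProduct d n n

m̃ : ℕ → ℕ → ℕ
m̃ d = sumUpTo (m d)

sum-single : ∀ (f : ℕ → ℕ) N a → a < N → (∀ i → i < N → i ≢ a → f i ≡ 0) →
             sum (applyUpTo f N) ≡ f a
sum-single f (suc N) zero _ z =
  trans (cong (f 0 +_) (sum-zero (f ∘ suc) N λ i i<N → z (suc i) (s≤s i<N) λ ()))
        (+-identityʳ (f 0))
  where
  sum-zero : ∀ (f : ℕ → ℕ) N → (∀ i → i < N → f i ≡ 0) → sum (applyUpTo f N) ≡ 0
  sum-zero f zero    z = refl
  sum-zero f (suc N) z =
    cong₂ _+_ (z 0 z<s) (sum-zero (f ∘ suc) N λ i i<N → z (suc i) (s≤s i<N))
sum-single f (suc N) (suc a) (s≤s a<N) z =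
  trans (cong (_+ sum (applyUpTo (f ∘ suc) N)) (z 0 z<s λ ()))
        (sum-single (f ∘ suc) N a a<N λ i i<N i≢a → z (suc i) (s≤s i<N) (i≢a ∘ suc-injective))

sumUpTo-single : ∀ f {n a} → a ≤ n → (∀ i → i ≤ n → i ≢ a → f i ≡ 0) → sumUpTo f n ≡ f a
sumUpTo-single f {n} {a} a≤n z =
  trans (cong sum (map-applyUpTo (λ i → i) f (suc n)))
        (sum-single f (suc n) a (s≤s a≤n) λ i i<n → z i (≤-pred i<n))

⊛-one : ∀ f {g n} → (∀ i → i ≤ n → g i ≡ one i) → (f ⊛ g) n ≡ f n
⊛-one f {g} {n} e = begin
  (f ⊛ g) n          ≡⟨ sumUpTo-single (λ i → f i * g (n ∸ i)) ≤-refl other ⟩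
  f n * g (n ∸ n)    ≡⟨ cong (λ j → f n * g j) (n∸n≡0 n) ⟩
  f n * g 0          ≡⟨ cong (f n *_) (e 0 z≤n) ⟩
  f n * 1            ≡⟨ *-identityʳ (f n) ⟩
  f n                ∎
  where
  open ≡-Reasoning
  one-pos : ∀ {i} → i ≢ 0 → one i ≡ 0
  one-pos {zero}  nz = contradiction refl nz
  one-pos {suc _} _  = refl
  other : ∀ i → i ≤ n → i ≢ n → f i * g (n ∸ i) ≡ 0
  other i i≤n i≢n = trans
    (cong (f i *_) (trans (e (n ∸ i) (m∸n≤m n i))
                          (one-pos λ z → i≢n (≤-antisym i≤n (m∸n≡0⇒m≤n z)))))
    (*-zeroʳ (f i))

geometric-yes : ∀ {k n} → k ∣ n → geometric k n ≡ 1
geometric-yes {k} {n} k∣n with k ∣? n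
... | yes _  = refl
... | no k∤n = contradiction k∣n k∤n

geometric-no : ∀ {k n} → ¬ k ∣ n → geometric k n ≡ 0
geometric-no {k} {n} k∤n with k ∣? n
... | yes k∣n = contradiction k∣n k∤n
... | no _    = refl

geometric-below : ∀ k i → i < k → geometric k i ≡ one i
geometric-below k zero    _   = geometric-yes (k ∣0)
geometric-below k (suc i) i<k = geometric-no λ k∣i → <⇒≱ i<k (∣⇒≤ k∣i)

↑-one : ∀ {g n} c → (∀ i → i ≤ n → g i ≡ one i) → ∀ i → i ≤ n → (g ↑ c) i ≡ one i
↑-one zero    e i i≤n = refl
↑-one {g} (suc c) e i i≤n =
  trans (⊛-one g λ j j≤i → ↑-one c e j (≤-trans j≤i i≤n)) (e i i≤n)

m-stable : ∀ d {n N} → n ≤ N → macMahonProduct d N n ≡ m d n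
m-stable d {n} n≤N = go (≤⇒≤′ n≤N)
  where
  go : ∀ {N} → n ≤′ N → macMahonProduct d N n ≡ m d n
  go ≤′-refl = refl
  go {suc N} (≤′-step n≤′N) = trans
    (⊛-one (macMahonProduct d N)
      (↑-one ((suc N + d ∸ 2) C (d ∸ 1)) λ i i≤n →
        geometric-below (suc N) i (s≤s (≤-trans i≤n (≤′⇒≤ n≤′N)))))
    (go n≤′N)

monomial : ℕ → Series
monomial k n with k ≟ n
... | yes _ = 1
... | no  _ = 0

monomial-yes : ∀ k → monomial k k ≡ 1
monomial-yes k with k ≟ k
... | yes _  = refl
... | no k≢k = contradiction refl k≢k

monomial-no : ∀ {k n} → n ≢ k → monomial k n ≡ 0
monomial-no {k} {n} n≢k with k ≟ n
... | yes k≡n = contradiction (sym k≡n) n≢k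
... | no _    = refl

-- (1 - x^k) · geometric k = 1, rearranged to avoid subtraction
geometric-inverse : ∀ k n → 1 ≤ k → geometric k n ≡ one n + (monomial k ⊛ geometric k) n
geometric-inverse k n 1≤k with k ≤? n
... | yes k≤n = begin
  geometric k n                                ≡⟨ shifted ⟩
  geometric k (n ∸ k)                          ≡⟨ *-identityˡ _ ⟨
  1 * geometric k (n ∸ k)                      ≡⟨ cong (_* geometric k (n ∸ k)) (monomial-yes k) ⟨
  monomial k k * geometric k (n ∸ k)           ≡⟨ sumUpTo-single (λ i → monomial k i * geometric k (n ∸ i)) k≤n
                                                    (λ i _ i≢k → cong (_* geometric k (n ∸ i)) (monomial-no i≢k)) ⟨
  (monomial k ⊛ geometric k) n                 ≡⟨ cong (_+ (monomial k ⊛ geometric k) n) (one-pos (≤-trans 1≤k k≤n)) ⟨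
  one n + (monomial k ⊛ geometric k) n         ∎
  where
  open ≡-Reasoning
  one-pos : ∀ {n} → 1 ≤ n → one n ≡ 0
  one-pos (s≤s _) = refl
  shifted : geometric k n ≡ geometric k (n ∸ k)
  shifted with k ∣? n ∸ k
  ... | yes k∣n∸k = geometric-yes (subst (k ∣_) (m+[n∸m]≡n k≤n) (∣m∣n⇒∣m+n ∣-refl k∣n∸k))
  ... | no k∤n∸k  =
    geometric-no λ k∣n → k∤n∸k (∣m+n∣m⇒∣n (subst (k ∣_) (sym (m+[n∸m]≡n k≤n)) k∣n) ∣-refl)
... | no k≰n = begin
  geometric k n                                ≡⟨ geometric-below k n (≰⇒> k≰n) ⟩
  one n                                        ≡⟨ +-identityʳ _ ⟨
  one n + 0                                    ≡⟨ cong (one n +_) (trans (sumUpTo-single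
                                                    (λ i → monomial k i * geometric k (n ∸ i)) z≤n
                                                    (λ i i≤n _ → vanish i i≤n)) (vanish 0 z≤n)) ⟨
  one n + (monomial k ⊛ geometric k) n         ∎
  where
  open ≡-Reasoning
  vanish : ∀ i → i ≤ n → monomial k i * geometric k (n ∸ i) ≡ 0
  vanish i i≤n = cong (_* geometric k (n ∸ i)) (monomial-no {k} {i} λ { refl → k≰n i≤n })

{-# OPTIONS --safe #-}

-- Put a i = π i - max_l π (i + e_l). By induction from the far positions, π is
-- determined by the array a. The weight Σ a i (|i| + 1), with coordinates
-- starting at 0, is the corner-hook volume of π; since binom(k+d-2, d-1)
-- positions have |i| + 1 = k, arrays of weight j are counted by m d j.
-- From a i + π (i + e_l) ≤ π i, Abel summation in the direction l gives
-- Σ a i (i_l + 1) ≤ |π|; summing over l, Σ a i (|i| + d) ≤ d |π|. If a ≠ 0,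
-- this bounds the weight by d |π| - (d - 1), so π ↦ a gives the first inequality.
-- For the second one, the empty partition improves it to p d n + 1 ≤ m̃ d N with
-- N = d n - d + 1, and m̃ d N ≤ 1 + N · m d N because m d is monotone.

module Submission where

open import Defs
open import Data.Nat using (ℕ; _+_; _*_; _∸_; _≤_)
open import Data.Product using (_×_)

open import Data.Fin using (Fin)
open import Data.List
  using (List; []; _∷_; _++_; [_]; map; length; upTo; allFin; concatMap; applyUpTo;
         cartesianProductWith)
open import Data.List.Membership.Propositional using (_∈_)
open import Data.List.Membership.Propositional.Properties hiding (finite)
open import Data.List.Properties hiding (sum-++)
open import Data.List.Relation.Binary.Disjoint.Propositional using (Disjoint)
open import Data.List.Relation.Unary.All as All using (All; []; _∷_)
import Data.List.Relation.Unary.All.Properties as All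
open import Data.List.Relation.Unary.AllPairs using ([]; _∷_)
import Data.List.Relation.Unary.AllPairs.Properties as AllPairs
open import Data.List.Relation.Unary.Any using (here; there)
open import Data.List.Relation.Unary.Unique.Propositional using (Unique)
import Data.List.Relation.Unary.Unique.Propositional.Properties as Unique
open import Data.Nat
open import Data.Nat.Combinatorics using (_C_; nCn≡1; nCk+nC[k+1]≡[n+1]C[k+1])
open import Data.Nat.Divisibility using (_∣?_; divides; 1∣_)
open import Data.Nat.ListAction using (sum)
open import Data.Nat.ListAction.Properties using (sum-++)
open import Data.Nat.Properties
open import Data.Nat.Tactic.RingSolver using (solve-∀)
open import Data.Product using (∃; _,_; proj₁; proj₂)
open import Data.Sum using (inj₁; inj₂)
open import Data.Vec as Vec using ([]; _∷_)
open import Data.Vec.Relation.Binary.Pointwise.Inductive as Pointwise using (Pointwise; []; _∷_)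
open import Function using (_∘_)
open import Function.Bundles using (Bijection)
open import Relation.Binary.PropositionalEquality hiding ([_])
open import Relation.Nullary using (yes; no; contradiction)

open Partition

private
  variable
    A X : Set
    d : ℕ

-- Finite sums

term≤sum : (f : A → ℕ) {x : A} {xs : List A} → x ∈ xs → f x ≤ sum (map f xs)
term≤sum f {x} {xs} x∈xs = subst (_≤ sum (map f xs)) (+-identityʳ (f x))
  (sum-mono f {[ x ]} ([] ∷ []) λ { (here refl) _ → x∈xs })

sum-map-≤ : {f g : A → ℕ} → ∀ xs → (∀ {x} → x ∈ xs → f x ≤ g x) →
            sum (map f xs) ≤ sum (map g xs)
sum-map-≤ []       f≤g = z≤n
sum-map-≤ (x ∷ xs) f≤g = +-mono-≤ (f≤g (here refl)) (sum-map-≤ xs (f≤g ∘ there))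

sum-map-+ : (f g : A → ℕ) → ∀ xs →
            sum (map (λ x → f x + g x) xs) ≡ sum (map f xs) + sum (map g xs)
sum-map-+ f g []       = refl
sum-map-+ f g (x ∷ xs) = trans (cong (f x + g x +_) (sum-map-+ f g xs)) (interchange (f x) (g x) _ _)
  where
  interchange : ∀ a b c e → a + b + (c + e) ≡ a + c + (b + e)
  interchange = solve-∀

sum-map-*ˡ : ∀ c (f : A → ℕ) xs → sum (map (λ x → c * f x) xs) ≡ c * sum (map f xs)
sum-map-*ˡ c f []       = sym (*-zeroʳ c)
sum-map-*ˡ c f (x ∷ xs) =
  trans (cong (c * f x +_) (sum-map-*ˡ c f xs)) (sym (*-distribˡ-+ c (f x) _))

sum-map-const : ∀ c (xs : List A) → sum (map (λ _ → c) xs) ≡ length xs * c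
sum-map-const c []       = refl
sum-map-const c (_ ∷ xs) = cong (c +_) (sum-map-const c xs)

sum-map-zero : (f g : A → ℕ) → ∀ xs → sum (map f xs) ≡ 0 → sum (map (λ x → f x * g x) xs) ≡ 0
sum-map-zero f g []       _ = refl
sum-map-zero f g (x ∷ xs) e = cong₂ _+_
  (cong (_* g x) (m+n≡0⇒m≡0 (f x) e)) (sum-map-zero f g xs (m+n≡0⇒n≡0 (f x) e))

length-concatMap : (f : A → List X) → ∀ xs →
  length (concatMap f xs) ≡ sum (map (length ∘ f) xs)
length-concatMap f []       = refl
length-concatMap f (x ∷ xs) =
  trans (length-++ (f x)) (cong (length (f x) +_) (length-concatMap f xs))

length-mono : {xs ys : List A} → Unique xs → (∀ {x} → x ∈ xs → x ∈ ys) → length xs ≤ length ys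
length-mono {xs = xs} {ys} u sub = subst₂ _≤_ (count xs) (count ys)
  (sum-mono (λ _ → 1) u λ x∈ _ → sub x∈)
  where
  count : ∀ (zs : List A) → sum (map (λ _ → 1) zs) ≡ length zs
  count zs = trans (sum-map-const 1 zs) (*-identityʳ _)

sumUpTo-suc : ∀ f n → sumUpTo f (suc n) ≡ f 0 + sumUpTo (f ∘ suc) n
sumUpTo-suc f n = cong (λ xs → f 0 + sum xs)
  (trans (map-applyUpTo suc f (suc n)) (sym (map-applyUpTo (λ i → i) (f ∘ suc) (suc n))))

map-≡⇒≡ : {B : Set} (f g : A → B) {xs : List A} → map f xs ≡ map g xs →
          ∀ {x} → x ∈ xs → f x ≡ g x
map-≡⇒≡ f g e (here refl) = ∷-injectiveˡ e
map-≡⇒≡ f g e (there x∈)  = map-≡⇒≡ f g (∷-injectiveʳ e) x∈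

-- Coefficients of products of geometric series

module _ (weight : X → ℕ) where

  totalWeight : (X → ℕ) → List X → ℕ
  totalWeight a xs = sum (map (λ x → a x * weight x) xs)

  -- Arrays enter only through their value lists on `xs`. The condition is one-sided: `vs` covers
  -- all arrays of weight `n`, so `f n` bounds their number from above.
  Enumerates : Series → List X → Set
  Enumerates f xs = ∀ n → ∃ λ (vs : List (List ℕ)) →
    length vs ≡ f n × (∀ a → totalWeight a xs ≡ n → map a xs ∈ vs)

  enumerates-one : Enumerates one []
  enumerates-one zero    = [ [] ] , refl , λ _ _ → here refl
  enumerates-one (suc n) = [] , refl , λ _ ()

  -- On one position, the weight `n` forces the value n / (k + 1): one array if the division is
  -- exact, none otherwise.
  enumerates-geometric : ∀ k {x} → weight x ≡ suc k → Enumerates (geometric (suc k)) [ x ]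
  enumerates-geometric k {x} w≡ n with suc k ∣? n
  ... | yes (divides q refl) = [ [ q ] ] , refl , λ a e →
        here (cong [_] (*-cancelʳ-≡ (a x) q (suc k) (trans (sym (singleton a)) e)))
    where
    singleton : ∀ a → totalWeight a [ x ] ≡ a x * suc k
    singleton a = trans (+-identityʳ _) (cong (a x *_) w≡)
  ... | no  k∤n = [] , refl , λ a e →
        contradiction (divides (a x) (trans (sym e) (trans (+-identityʳ _) (cong (a x *_) w≡)))) k∤n

  -- The Cauchy product distributes the weight: an array with weight `i` on `xs` has weight `n ∸ i`
  -- on `ys`.
  enumerates-⊛ : ∀ {f g xs ys} → Enumerates f xs → Enumerates g ys →
                 Enumerates (f ⊛ g) (xs ++ ys)
  enumerates-⊛ {f} {g} {xs} {ys} F G n =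
    concatMap pairs (upTo (suc n)) , len , complete
    where
    pairs : ℕ → List (List ℕ)
    pairs i = cartesianProductWith _++_ (proj₁ (F i)) (proj₁ (G (n ∸ i)))
    len : length (concatMap pairs (upTo (suc n))) ≡ (f ⊛ g) n
    len = trans (length-concatMap pairs (upTo (suc n)))
      (cong sum (map-cong (λ i → trans (length-cartesianProductWith (proj₁ (F i)) _)
        (cong₂ _*_ (proj₁ (proj₂ (F i))) (proj₁ (proj₂ (G (n ∸ i)))))) (upTo (suc n))))
      where
      length-cartesianProductWith : ∀ us vs →
        length (cartesianProductWith (_++_ {A = ℕ}) us vs) ≡ length us * length vs
      length-cartesianProductWith []       vs = refl
      length-cartesianProductWith (u ∷ us) vs = trans (length-++ (map (u ++_) vs))
        (cong₂ _+_ (length-map _ vs) (length-cartesianProductWith us vs))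
    complete : ∀ a → totalWeight a (xs ++ ys) ≡ n →
               map a (xs ++ ys) ∈ concatMap pairs (upTo (suc n))
    complete a e = subst (_∈ concatMap pairs (upTo (suc n))) (sym (map-++ a xs ys))
      (∈-concat⁺′ (∈-cartesianProductWith⁺ _++_
          (proj₂ (proj₂ (F i)) a refl)
          (proj₂ (proj₂ (G (n ∸ i))) a (trans (sym (m+n∸m≡n i _)) (cong (_∸ i) split))))
        (∈-map⁺ pairs (∈-upTo⁺ (s≤s (subst (i ≤_) split (m≤m+n i _))))))
      where
      i : ℕ
      i = totalWeight a xs
      split : i + totalWeight a ys ≡ n
      split = trans (sym (trans (cong sum (map-++ _ xs ys)) (sum-++ (map _ xs) _))) e

  enumerates-↑ : ∀ k xs → All (λ x → weight x ≡ suc k) xs →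
                 Enumerates (geometric (suc k) ↑ length xs) xs
  enumerates-↑ k []       []       = enumerates-one
  enumerates-↑ k (x ∷ xs) (w≡ ∷ e) =
    enumerates-⊛ (enumerates-geometric k w≡) (enumerates-↑ k xs e)

-- Positions by coordinate sum

incrementHead : Position (suc d) → Position (suc d)
incrementHead (x ∷ i) = suc x ∷ i

-- The split by whether the first coordinate is zero or positive mirrors Pascal's rule, which then
-- gives the length.
level : (d s : ℕ) → List (Position d)
level zero    zero    = [ [] ]
level zero    (suc _) = []
level (suc d) zero    = map (0 ∷_) (level d 0)
level (suc d) (suc s) = map (0 ∷_) (level d (suc s)) ++ map incrementHead (level (suc d) s)

∈-level : (i : Position d) → i ∈ level d (Vec.sum i)
∈-level []          = here refl
∈-level (zero ∷ i)  = zero-∈ (Vec.sum i) (∈-level i)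
  where
  zero-∈ : ∀ {d} {i : Position d} s → i ∈ level d s → 0 ∷ i ∈ level (suc d) s
  zero-∈ zero    i∈ = ∈-map⁺ (0 ∷_) i∈
  zero-∈ (suc s) i∈ = ∈-++⁺ˡ (∈-map⁺ (0 ∷_) i∈)
∈-level (suc x ∷ i) = ∈-++⁺ʳ _ (∈-map⁺ incrementHead (∈-level (x ∷ i)))

level-sum : ∀ d s {i} → i ∈ level d s → Vec.sum i ≡ s
level-sum zero    zero    (here refl) = refl
level-sum (suc d) zero    i∈ with ∈-map⁻ (0 ∷_) i∈
... | _ , j∈ , refl = level-sum d 0 j∈
level-sum (suc d) (suc s) i∈ with ∈-++⁻ (map (0 ∷_) (level d (suc s))) i∈
... | inj₁ i∈ˡ with ∈-map⁻ (0 ∷_) i∈ˡ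
...   | _ , j∈ , refl = level-sum d (suc s) j∈
level-sum (suc d) (suc s) i∈ | inj₂ i∈ʳ with ∈-map⁻ incrementHead i∈ʳ
...   | (_ ∷ _) , j∈ , refl = cong suc (level-sum (suc d) s j∈)

level-unique : ∀ d s → Unique (level d s)
level-unique zero    zero    = [] ∷ []
level-unique zero    (suc s) = []
level-unique (suc d) zero    = Unique.map⁺ (λ { refl → refl }) (level-unique d 0)
level-unique (suc d) (suc s) = Unique.++⁺
  (Unique.map⁺ (λ { refl → refl }) (level-unique d (suc s)))
  (Unique.map⁺ (λ { {_ ∷ _} {_ ∷ _} refl → refl }) (level-unique (suc d) s))
  disjoint
  where
  disjoint : Disjoint (map (0 ∷_) (level d (suc s))) (map incrementHead (level (suc d) s))
  disjoint (i∈ˡ , i∈ʳ) with ∈-map⁻ (0 ∷_) i∈ˡ | ∈-map⁻ incrementHead i∈ʳ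
  ... | _ , _ , refl | (_ ∷ _) , _ , ()

length-level : ∀ e s → length (level (suc e) s) ≡ (s + e) C e
length-level zero    zero    = refl
length-level zero    (suc s) = trans (length-map incrementHead (level 1 s)) (length-level zero s)
length-level (suc e) zero    = trans (length-map (0 ∷_) (level (suc e) 0))
  (trans (length-level e 0) (trans (nCn≡1 e) (sym (nCn≡1 (suc e)))))
length-level (suc e) (suc s) = begin
  length (map (0 ∷_) (level (suc e) (suc s)) ++ map incrementHead (level (suc (suc e)) s))
    ≡⟨ length-++ (map (0 ∷_) (level (suc e) (suc s))) ⟩
  length (map (Vec._∷_ 0) (level (suc e) (suc s))) + length (map incrementHead (level (suc (suc e)) s))
    ≡⟨ cong₂ _+_ (trans (length-map _ (level (suc e) (suc s))) (length-level e (suc s)))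
                 (trans (length-map _ (level (suc (suc e)) s)) (length-level (suc e) s)) ⟩
  (suc s + e) C e + (s + suc e) C suc e
    ≡⟨ cong (λ k → k C e + (s + suc e) C suc e) (+-suc s e) ⟨
  (s + suc e) C e + (s + suc e) C suc e
    ≡⟨ nCk+nC[k+1]≡[n+1]C[k+1] (s + suc e) e ⟩
  (suc s + suc e) C suc e ∎
  where open ≡-Reasoning

below : (d N : ℕ) → List (Position d)
below d zero    = []
below d (suc N) = below d N ++ level d N

∈-below⁺ : ∀ N {i : Position d} → Vec.sum i < N → i ∈ below d N
∈-below⁺ (suc N) {i} i<N with Vec.sum i ≟ N
... | yes refl = ∈-++⁺ʳ (below _ N) (∈-level i)
... | no  i≢N  = ∈-++⁺ˡ (∈-below⁺ N (≤∧≢⇒< (≤-pred i<N) i≢N))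

∈-below⁻ : ∀ d N {i : Position d} → i ∈ below d N → Vec.sum i < N
∈-below⁻ d (suc N) i∈ with ∈-++⁻ (below d N) i∈
... | inj₁ i∈ˡ = m≤n⇒m≤1+n (∈-below⁻ d N i∈ˡ)
... | inj₂ i∈ʳ = s≤s (≤-reflexive (level-sum d N i∈ʳ))

below-unique : ∀ d N → Unique (below d N)
below-unique d zero    = []
below-unique d (suc N) = Unique.++⁺ (below-unique d N) (level-unique d N)
  λ (i∈ˡ , i∈ʳ) → <⇒≢ (∈-below⁻ d N i∈ˡ) (level-sum d N i∈ʳ)

height : Position d → ℕ
height i = suc (Vec.sum i)

-- Each position of height k accounts for one factor (1 - x^k)⁻¹. Level `N` consists of the binom(N
-- + e, e) positions of height `suc N`, and this is the exponent of the factor for k = N + 1.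
macMahonProduct-enumerates : ∀ e N →
  Enumerates height (macMahonProduct (suc e) N) (below (suc e) N)
macMahonProduct-enumerates e zero    = enumerates-one height
macMahonProduct-enumerates e (suc N) = enumerates-⊛ height (macMahonProduct-enumerates e N)
  (subst (λ c → Enumerates height (geometric (suc N) ↑ c) (level (suc e) N))
    (trans (length-level e N) (cong (λ k → (k ∸ 1) C e) (sym (+-suc N e))))
    (enumerates-↑ height N (level (suc e) N)
      (All.tabulate λ i∈ → cong suc (level-sum (suc e) N i∈))))

-- Peaks of a partition

-- This is max_l f (i + e_l), with 0 as the empty maximum.
above : (Position d → ℕ) → Position d → ℕ
above f []      = 0
above f (x ∷ i) = f (suc x ∷ i) ⊔ above (λ j → f (x ∷ j)) i

-- All i + e_l lie exactly one level higher, which allows induction on levels in `peak-injective`.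
above-cong : {f g : Position d → ℕ} (i : Position d) →
  (∀ j → Vec.sum j ≡ suc (Vec.sum i) → f j ≡ g j) → above f i ≡ above g i
above-cong []      _ = refl
above-cong (x ∷ i) e = cong₂ _⊔_ (e (suc x ∷ i) refl)
  (above-cong i λ j s → e (x ∷ j) (trans (cong (x +_) s) (+-suc x _)))

above-≤ : {f : Position d → ℕ} → (∀ {i j} → Pointwise _≤_ i j → f j ≤ f i) →
          ∀ i → above f i ≤ f i
above-≤ anti []      = z≤n
above-≤ anti (x ∷ i) = ⊔-lub (anti (n≤1+n x ∷ Pointwise.refl ≤-refl))
  (above-≤ (λ le → anti (≤-refl ∷ le)) i)

-- Abel summation along a line. Only weights w x = c + x occur; w is kept
-- abstract so that the induction can pass to w ∘ suc.
line-sum-≤ : ∀ n (w a f : ℕ → ℕ) → (∀ x → w (suc x) ≡ suc (w x)) →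
  (∀ x → a x + f (suc x) ≤ f x) →
  sum (applyUpTo (λ x → w (suc x) * a x) n) ≤ w 0 * f 0 + sum (applyUpTo f n)
line-sum-≤ zero    w a f w-suc h = z≤n
line-sum-≤ (suc n) w a f w-suc h = begin
  w 1 * a 0 + sum (applyUpTo (λ x → w (suc (suc x)) * a (suc x)) n)
    ≤⟨ +-monoʳ-≤ (w 1 * a 0) (line-sum-≤ n (w ∘ suc) (a ∘ suc) (f ∘ suc) (w-suc ∘ suc) (h ∘ suc)) ⟩
  w 1 * a 0 + (w 1 * f 1 + rest)   ≡⟨ +-assoc (w 1 * a 0) _ rest ⟨
  w 1 * a 0 + w 1 * f 1 + rest     ≡⟨ cong (_+ rest) (*-distribˡ-+ (w 1) (a 0) (f 1)) ⟨
  w 1 * (a 0 + f 1) + rest         ≤⟨ +-monoˡ-≤ rest (*-monoʳ-≤ (w 1) (h 0)) ⟩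
  w 1 * f 0 + rest                 ≡⟨ cong (λ k → k * f 0 + rest) (w-suc 0) ⟩
  f 0 + w 0 * f 0 + rest           ≡⟨ cong (_+ rest) (+-comm (f 0) _) ⟩
  w 0 * f 0 + f 0 + rest           ≡⟨ +-assoc (w 0 * f 0) _ rest ⟩
  w 0 * f 0 + (f 0 + rest)         ∎
  where
  open ≤-Reasoning
  rest : ℕ
  rest = sum (applyUpTo (f ∘ suc) n)

box-sum : ∀ (f : Position (suc d) → ℕ) n →
  sum (map f (box (suc d) n)) ≡ sum (map (λ x → sum (map (λ i → f (x ∷ i)) (box d n))) (upTo n))
box-sum {d} f n = go (upTo n)
  where
  go : ∀ xs → sum (map f (cartesianProductWith _∷_ xs (box d n))) ≡
              sum (map (λ x → sum (map (λ i → f (x ∷ i)) (box d n))) xs)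
  go []       = refl
  go (x ∷ xs) = begin
    sum (map f (map (x ∷_) (box d n) ++ cartesianProductWith _∷_ xs (box d n)))
      ≡⟨ cong sum (map-++ f (map (x ∷_) (box d n)) _) ⟩
    sum (map f (map (x ∷_) (box d n)) ++ map f (cartesianProductWith _∷_ xs (box d n)))
      ≡⟨ sum-++ (map f (map (x ∷_) (box d n))) _ ⟩
    sum (map f (map (x ∷_) (box d n))) + sum (map f (cartesianProductWith _∷_ xs (box d n)))
      ≡⟨ cong₂ _+_ (cong sum (sym (map-∘ (box d n)))) (go xs) ⟩
    sum (map (λ i → f (x ∷ i)) (box d n)) + sum (map (λ x → sum (map (λ i → f (x ∷ i)) (box d n))) xs) ∎
    where open ≡-Reasoning

-- Induction on the dimension. The weight splits as (x + 1) + (|i| + d): the second summand is the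
-- induction hypothesis inside each slice and contributes d copies of the sum of `f`; the first is
-- Abel summation across the slices and contributes one more.
box-sum-≤ : ∀ d n (a f : Position d → ℕ) → (∀ i → a i + above f i ≤ f i) →
  sum (map (λ i → a i * (Vec.sum i + d)) (box d n)) ≤ d * sum (map f (box d n))
box-sum-≤ zero    n a f h = ≤-reflexive (trans (+-identityʳ (a [] * 0)) (*-zeroʳ (a [])))
box-sum-≤ (suc d) n a f h = begin
  sum (map (λ i → a i * (Vec.sum i + suc d)) (box (suc d) n))
    ≡⟨ box-sum (λ i → a i * (Vec.sum i + suc d)) n ⟩
  sum (map (λ x → sum (map (λ i → a (x ∷ i) * (x + Vec.sum i + suc d)) (box d n))) (upTo n))
    ≤⟨ sum-map-≤ (upTo n) (λ {x} _ → slice-≤ x) ⟩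
  sum (map (λ x → suc x * sliceSum a x + d * sliceSum f x) (upTo n))
    ≡⟨ trans (sum-map-+ (λ x → suc x * sliceSum a x) (λ x → d * sliceSum f x) (upTo n))
             (cong (sum (map (λ x → suc x * sliceSum a x) (upTo n)) +_) (sum-map-*ˡ d (sliceSum f) (upTo n))) ⟩
  sum (map (λ x → suc x * sliceSum a x) (upTo n)) + d * sum (map (sliceSum f) (upTo n))
    ≤⟨ +-monoˡ-≤ (d * sum (map (sliceSum f) (upTo n)))
         (subst₂ _≤_ (cong sum (sym (map-applyUpTo (λ x → x) (λ x → suc x * sliceSum a x) n)))
                     (cong sum (sym (map-applyUpTo (λ x → x) (sliceSum f) n)))
           -- For the identity weight the boundary term `w 0 * f 0` computes to 0.
           (line-sum-≤ n (λ x → x) (sliceSum a) (sliceSum f) (λ _ → refl) step)) ⟩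
  suc d * sum (map (sliceSum f) (upTo n))
    ≡⟨ cong (suc d *_) (box-sum f n) ⟨
  suc d * sum (map f (box (suc d) n)) ∎
  where
  open ≤-Reasoning
  sliceSum : (Position (suc d) → ℕ) → ℕ → ℕ
  sliceSum g x = sum (map (λ i → g (x ∷ i)) (box d n))
  split : ∀ b x s d → b * (x + s + suc d) ≡ suc x * b + b * (s + d)
  split = solve-∀
  slice-≤ : ∀ x → sum (map (λ i → a (x ∷ i) * (x + Vec.sum i + suc d)) (box d n)) ≤
                  suc x * sliceSum a x + d * sliceSum f x
  slice-≤ x = begin
    sum (map (λ i → a (x ∷ i) * (x + Vec.sum i + suc d)) (box d n))
      ≡⟨ cong sum (map-cong (λ i → split (a (x ∷ i)) x (Vec.sum i) d) (box d n)) ⟩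
    sum (map (λ i → suc x * a (x ∷ i) + a (x ∷ i) * (Vec.sum i + d)) (box d n))
      ≡⟨ sum-map-+ (λ i → suc x * a (x ∷ i)) (λ i → a (x ∷ i) * (Vec.sum i + d)) (box d n) ⟩
    sum (map (λ i → suc x * a (x ∷ i)) (box d n)) + sum (map (λ i → a (x ∷ i) * (Vec.sum i + d)) (box d n))
      ≤⟨ +-mono-≤ (≤-reflexive (sum-map-*ˡ (suc x) (λ i → a (x ∷ i)) (box d n)))
           (box-sum-≤ d n (λ i → a (x ∷ i)) (λ i → f (x ∷ i)) λ i →
             ≤-trans (+-monoʳ-≤ (a (x ∷ i)) (m≤n⊔m (f (suc x ∷ i)) _)) (h (x ∷ i))) ⟩
    suc x * sliceSum a x + d * sliceSum f x ∎
  -- Only the first direction of the maximum is used here; `slice-≤` uses the remaining ones.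
  step : ∀ x → sliceSum a x + sliceSum f (suc x) ≤ sliceSum f x
  step x = subst (_≤ sliceSum f x) (sum-map-+ (λ i → a (x ∷ i)) (λ i → f (suc x ∷ i)) (box d n))
    (sum-map-≤ (box d n) λ {i} _ → ≤-trans (+-monoʳ-≤ (a (x ∷ i)) (m≤m⊔n (f (suc x ∷ i)) _)) (h (x ∷ i)))

peak : (Position d → ℕ) → Position d → ℕ
peak f i = f i ∸ above f i

-- By antitonicity the truncated subtraction in `peak` is exact.
peak+above : (π : Partition d) → ∀ i → peak (entry π) i + above (entry π) i ≡ entry π i
peak+above π i = m∸n+n≡m (above-≤ (antitone π) i)

-- An entry is determined by its peak value and the entries one level higher,
-- and the entries of both partitions vanish on all high levels.
peak-injective : (π ρ : Partition d) → (∀ i → peak (entry π) i ≡ peak (entry ρ) i) →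
                 ∀ i → entry π i ≡ entry ρ i
peak-injective π ρ e i = go (bound π + bound ρ) i (m≤m+n (bound π + bound ρ) _)
  where
  bound : Partition _ → ℕ
  -- The total over the support is at least each single coordinate sum in it; the successor makes
  -- this strict.
  bound σ = suc (sum (map Vec.sum (support σ)))
  vanish : ∀ σ i → bound σ ≤ Vec.sum i → entry σ i ≡ 0
  vanish σ i le with entry σ i ≟ 0
  ... | yes z = z
  ... | no nz = contradiction (term≤sum Vec.sum (finite σ nz)) (<⇒≱ le)
  -- `k` bounds the number of levels left before both partitions vanish.
  go : ∀ k i → bound π + bound ρ ≤ k + Vec.sum i → entry π i ≡ entry ρ i
  go zero    i le = trans (vanish π i (≤-trans (m≤m+n (bound π) (bound ρ)) le))
                          (sym (vanish ρ i (≤-trans (m≤n+m (bound ρ) (bound π)) le)))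
  go (suc k) i le = begin
    entry π i                                  ≡⟨ peak+above π i ⟨
    peak (entry π) i + above (entry π) i       ≡⟨ cong₂ _+_ (e i) (above-cong i λ j s →
                                                    go k j (≤-trans le (≤-reflexive (step s)))) ⟩
    peak (entry ρ) i + above (entry ρ) i       ≡⟨ peak+above ρ i ⟩
    entry ρ i                                  ∎
    where
    open ≡-Reasoning
    step : ∀ {s} → s ≡ suc (Vec.sum i) → suc k + Vec.sum i ≡ k + s
    step refl = sym (+-suc k _)

-- Bounding the corner-hook volume

cornerHookVolume : Partition d → List (Position d) → ℕ
cornerHookVolume π = totalWeight height (peak (entry π))

-- With d = e + 1, `box-sum-≤` bounds the weight plus e Σ a by d |π|. The list `xs` is arbitrary, so
-- that the bound applies both to a single position and to `below`.
cornerHookVolume-≤ : ∀ {e k} (π : Partition (suc e)) → volume π ≤ suc k →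
  ∀ {xs} → Unique xs → cornerHookVolume π xs ≤ suc e * suc k ∸ suc e + 1
cornerHookVolume-≤ {e} {k} π v≤n {xs} u = begin
  -- A nonzero peak forces a nonzero entry, hence a position in the box.
  cornerHookVolume π xs         ≤⟨ sum-mono (λ i → a i * height i) u (λ {i} _ nz → nonzero⇒∈box π λ z →
                                     nz (cong (_* height i) (n≤0⇒n≡0 (≤-trans (m∸n≤m (entry π i) (above (entry π) i)) (≤-reflexive z))))) ⟩
  cornerHookVolume π B          ≤⟨ bounded ⟩
  suc e * k + 1                 ≡⟨ cong (_+ 1) (m+n∸n≡m (suc e * k) (suc e)) ⟨
  suc e * k + suc e ∸ suc e + 1 ≡⟨ cong (λ t → t ∸ suc e + 1) (trans (+-comm _ (suc e)) (sym (*-suc (suc e) k))) ⟩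
  suc e * suc k ∸ suc e + 1     ∎
  where
  open ≤-Reasoning
  a : Position (suc e) → ℕ
  a = peak (entry π)
  B : List (Position (suc e))
  B = box (suc e) (volume π)
  split : ∀ b s e → b * (s + suc e) ≡ b * suc s + e * b
  split = solve-∀
  regroup : ∀ e k → suc e * suc k ≡ suc e * k + 1 + e
  regroup = solve-∀
  abel : cornerHookVolume π B + e * sum (map a B) ≤ suc e * suc k
  abel = begin
    cornerHookVolume π B + e * sum (map a B)
      ≡⟨ cong (cornerHookVolume π B +_) (sum-map-*ˡ e a B) ⟨
    cornerHookVolume π B + sum (map (λ i → e * a i) B)
      ≡⟨ sum-map-+ (λ i → a i * height i) (λ i → e * a i) B ⟨
    sum (map (λ i → a i * height i + e * a i) B)
      ≡⟨ cong sum (map-cong (λ i → split (a i) (Vec.sum i) e) B) ⟨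
    sum (map (λ i → a i * (Vec.sum i + suc e)) B)
      ≤⟨ box-sum-≤ (suc e) (volume π) a (entry π) (≤-reflexive ∘ peak+above π) ⟩
    suc e * sum (map (entry π) B)
      ≤⟨ *-monoʳ-≤ (suc e) (sum-mono (entry π) (box-unique (suc e) (volume π)) λ _ → finite π) ⟩
    suc e * volume π
      ≤⟨ *-monoʳ-≤ (suc e) v≤n ⟩
    suc e * suc k ∎
  bounded : cornerHookVolume π B ≤ suc e * k + 1
  -- If Σ a ≥ 1, then e Σ a ≥ e can be cancelled from the bound; if Σ a = 0, the weight itself is 0.
  bounded with sum (map a B) ≟ 0
  ... | yes z = ≤-trans (≤-reflexive (sum-map-zero a height B z)) z≤n
  ... | no nz = +-cancelʳ-≤ e _ _ (begin
    cornerHookVolume π B + e                    ≤⟨ +-monoʳ-≤ (cornerHookVolume π B)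
                                                     (m≤m*n e (sum (map a B)) {{≢-nonZero nz}}) ⟩
    cornerHookVolume π B + e * sum (map a B)    ≤⟨ abel ⟩
    suc e * suc k                               ≡⟨ regroup e k ⟩
    suc e * k + 1 + e                           ∎)

-- Comparing the two counts

Unique-concatMap-upTo : (f : ℕ → List A) → ∀ n → (∀ {k} → k < n → Unique (f k)) →
  (∀ {j k} → j < k → k < n → Disjoint (f j) (f k)) → Unique (concatMap f (upTo n))
Unique-concatMap-upTo f n u dis = Unique.concat⁺
  (All.map⁺ (All.applyUpTo⁺₁ (λ k → k) n u))
  (AllPairs.map⁺ (AllPairs.applyUpTo⁺₁ (λ k → k) n dis))

module _ (e k : ℕ) where

  private
    N : ℕ
    N = suc e * suc k ∸ suc e + 1

  peaks : Partition (suc e) → List ℕ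
  peaks π = map (peak (entry π)) (below (suc e) N)

  -- A nonzero peak at `i` adds at least `height i` to a weight that is at most `N`. So all peaks
  -- outside `below` vanish, and the finite list `peaks` loses nothing.
  peaks-injective : ∀ π ρ → volume π ≤ suc k → volume ρ ≤ suc k → peaks π ≡ peaks ρ →
                    ∀ i → entry π i ≡ entry ρ i
  peaks-injective π ρ π≤ ρ≤ eq = peak-injective π ρ same
    where
    vanish : ∀ σ → volume σ ≤ suc k → ∀ i → N ≤ Vec.sum i → peak (entry σ) i ≡ 0
    vanish σ σ≤ i le with peak (entry σ) i ≟ 0
    ... | yes z = z
    ... | no nz = contradiction le (<⇒≱ (begin
      height i                             ≤⟨ m≤n*m (height i) (peak (entry σ) i) {{≢-nonZero nz}} ⟩
      peak (entry σ) i * height i          ≡⟨ +-identityʳ _ ⟨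
      cornerHookVolume σ [ i ]             ≤⟨ cornerHookVolume-≤ σ σ≤ {[ i ]} ([] ∷ []) ⟩
      N                                    ∎))
      where open ≤-Reasoning
    same : ∀ i → peak (entry π) i ≡ peak (entry ρ) i
    same i with Vec.sum i <? N
    ... | yes i<N = map-≡⇒≡ (peak (entry π)) (peak (entry ρ)) eq {i} (∈-below⁺ N i<N)
    ... | no  i≮N = trans (vanish π π≤ i (≮⇒≥ i≮N)) (sym (vanish ρ ρ≤ i (≮⇒≥ i≮N)))

  -- The peak lists of all partitions of volume at most k + 1 form a repetition-free list contained
  -- in the list of arrays of weight at most `N`, so the lengths compare.
  sumUpTo-cardinality-≤ : {count : ℕ → ℕ} →
    (∀ v → HasCardinality (partitions (suc e) v) (count v)) →
    sumUpTo count (suc k) ≤ m̃ (suc e) N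
  sumUpTo-cardinality-≤ {count} bijection = begin
    sumUpTo count (suc k)                          ≡⟨ cong sum (map-cong length-images (upTo (2 + k))) ⟨
    sum (map (length ∘ images) (upTo (2 + k)))     ≡⟨ length-concatMap images (upTo (2 + k)) ⟨
    length (concatMap images (upTo (2 + k)))       ≤⟨ length-mono unique-images included ⟩
    length (concatMap arrays (upTo (suc N)))       ≡⟨ length-concatMap arrays (upTo (suc N)) ⟩
    -- The arrays come from the product truncated at `N`, whose coefficients up to `N` are already
    -- final.
    sum (map (length ∘ arrays) (upTo (suc N)))     ≡⟨ cong sum (map-cong-local {xs = upTo (suc N)} (All.tabulate λ {j} j∈ →
                                                        trans (proj₁ (proj₂ (enumeration j)))
                                                              (m-stable (suc e) {j} {N} (≤-pred (∈-upTo⁻ j∈))))) ⟩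
    m̃ (suc e) N                                    ∎
    where
    open ≤-Reasoning
    enumeration : Enumerates height (macMahonProduct (suc e) N) (below (suc e) N)
    enumeration = macMahonProduct-enumerates e N
    arrays : ℕ → List (List ℕ)
    arrays j = proj₁ (enumeration j)
    partition : ∀ v → Fin (count v) → Partition (suc e)
    partition v a = proj₁ (Bijection.to (bijection v) a)
    volume-partition : ∀ v a → volume (partition v a) ≡ v
    volume-partition v a = proj₂ (Bijection.to (bijection v) a)
    volume-≤ : ∀ {v} → v < 2 + k → ∀ a → volume (partition v a) ≤ suc k
    volume-≤ v< a = ≤-trans (≤-reflexive (volume-partition _ a)) (≤-pred v<)
    images : ℕ → List (List ℕ)
    images v = map (peaks ∘ partition v) (allFin (count v))
    length-images : ∀ v → length (images v) ≡ count v
    length-images v = trans (length-map _ (allFin (count v))) (length-tabulate (λ a → a))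
    unique-images : Unique (concatMap images (upTo (2 + k)))
    unique-images = Unique-concatMap-upTo images (2 + k)
      (λ {v} v< → Unique.map⁺
        (λ {a} {b} eq → Bijection.injective (bijection v)
          (peaks-injective (partition v a) (partition v b) (volume-≤ v< a) (volume-≤ v< b) eq))
        (Unique.allFin⁺ _))
      disjoint
      where
      -- A common peak list would give equal entries and hence equal volumes.
      disjoint : ∀ {u v} → u < v → v < 2 + k → Disjoint (images u) (images v)
      disjoint {u} {v} u<v v< (x∈u , x∈v)
        with ∈-map⁻ (peaks ∘ partition u) x∈u | ∈-map⁻ (peaks ∘ partition v) x∈v
      ... | a , _ , refl | b , _ , eq = <⇒≢ u<v (trans (sym (volume-partition u a))
        (trans (volume-cong (partition u a) (partition v b)
                 (peaks-injective (partition u a) (partition v b) (volume-≤ (<-trans u<v v<) a) (volume-≤ v< b) eq))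
               (volume-partition v b)))
    included : ∀ {x} → x ∈ concatMap images (upTo (2 + k)) → x ∈ concatMap arrays (upTo (suc N))
    included x∈ with ∈-concat⁻′ (map images (upTo (2 + k))) x∈
    ... | _ , x∈v , v∈ with ∈-map⁻ images v∈
    ...   | v , v∈′ , refl with ∈-map⁻ (peaks ∘ partition v) x∈v
    -- The block containing this array is indexed by its corner-hook volume, which is at most `N`.
    ...     | a , _ , refl = ∈-concat⁺′ (proj₂ (proj₂ (enumeration _)) (peak (entry (partition v a))) refl)
      (∈-map⁺ arrays (∈-upTo⁺ (s≤s (cornerHookVolume-≤ (partition v a) (volume-≤ (∈-upTo⁻ v∈′) a)
        (below-unique (suc e) N)))))

p̃≤m̃ : ∀ e k → p̃ (suc e) (suc k) ≤ m̃ (suc e) (suc e * suc k ∸ suc e + 1)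
p̃≤m̃ e k = sumUpTo-cardinality-≤ e k λ v → proj₂ (partitions-finite (suc e) v)

-- The second inequality

emptyPartition : Partition d
emptyPartition = record
  { entry    = λ _ → 0
  ; antitone = λ _ → z≤n
  ; support  = []
  ; unique   = []
  ; finite   = λ nz → contradiction refl nz
  }

p-zero : ∀ d → 1 ≤ p d 0
p-zero d = inhabited (proj₁ (Bijection.surjective (proj₂ (partitions-finite d 0)) (emptyPartition , refl)))
  where
  inhabited : ∀ {n} → Fin n → 1 ≤ n
  inhabited {suc _} _ = s≤s z≤n

-- The empty partition has volume 0, different from k + 1, and supplies the extra 1.
p<p̃ : ∀ d k → suc (p d (suc k)) ≤ p̃ d (suc k)
p<p̃ d k = subst (suc (p d (suc k)) ≤_) (sym (sumUpTo-suc (p d) k))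
  (+-mono-≤ (p-zero d) (term≤sum (p d ∘ suc) (∈-upTo⁺ ≤-refl)))

-- Drop the term for index 0 in the coefficient at `suc n`; the term for i + 1 then dominates the
-- old term for i, with the same factor `g (n ∸ i)`.
⊛-monotone : ∀ {f} g → (∀ n → f n ≤ f (suc n)) → ∀ n → (f ⊛ g) n ≤ (f ⊛ g) (suc n)
⊛-monotone {f} g mono n = subst ((f ⊛ g) n ≤_) (sym (sumUpTo-suc (λ i → f i * g (suc n ∸ i)) n))
  (m≤n⇒m≤o+n (f 0 * g (suc n)) (sum-map-≤ (upTo (suc n)) λ {i} _ → *-monoˡ-≤ (g (n ∸ i)) (mono i)))

-- The first factor of the product is (1 - x)⁻¹ to the power binom(d-1, d-1) = 1.
macMahonProduct-monotone : ∀ e N n →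
  macMahonProduct (suc e) (suc N) n ≤ macMahonProduct (suc e) (suc N) (suc n)
macMahonProduct-monotone e zero n = ≤-reflexive (trans (ones n) (sym (ones (suc n))))
  where
  ones : ∀ n → macMahonProduct (suc e) 1 n ≡ 1
  ones n = begin
    (one ⊛ geometric 1 ↑ (e C e)) n     ≡⟨ cong (λ c → (one ⊛ geometric 1 ↑ c) n) (nCn≡1 e) ⟩
    (one ⊛ (geometric 1 ⊛ one)) n       ≡⟨ sumUpTo-single (λ i → one i * (geometric 1 ⊛ one) (n ∸ i)) {n} z≤n
                                             (λ { zero _ 0≢0 → contradiction refl 0≢0 ; (suc _) _ _ → refl }) ⟩
    1 * (geometric 1 ⊛ one) n           ≡⟨ *-identityˡ _ ⟩
    (geometric 1 ⊛ one) n               ≡⟨ ⊛-one (geometric 1) (λ _ _ → refl) ⟩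
    geometric 1 n                       ≡⟨ geometric-yes (1∣ n) ⟩
    1                                   ∎
    where open ≡-Reasoning
macMahonProduct-monotone e (suc N) n =
  ⊛-monotone (geometric (2 + N) ↑ ((2 + N + suc e ∸ 2) C e)) (macMahonProduct-monotone e N) n

-- By stability both numbers are coefficients of the single product truncated at `N`.
m-monotone : ∀ e {j N} → 1 ≤ j → j ≤ N → m (suc e) j ≤ m (suc e) N
m-monotone e {suc j} {suc N} 1≤j j≤N =
  subst (_≤ m (suc e) (suc N)) (m-stable (suc e) j≤N) (go (≤⇒≤′ j≤N))
  where
  go : ∀ {i} → suc j ≤′ i → macMahonProduct (suc e) (suc N) (suc j) ≤ macMahonProduct (suc e) (suc N) i
  go ≤′-refl       = ≤-refl
  go (≤′-step j≤i) = ≤-trans (go j≤i) (macMahonProduct-monotone e N _)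

-- The term for index 0 is 1, and monotonicity bounds each of the other `N` terms.
m̃≤1+N*m : ∀ e N → m̃ (suc e) N ≤ suc (N * m (suc e) N)
m̃≤1+N*m e zero    = ≤-refl
m̃≤1+N*m e (suc N) = subst (_≤ suc (suc N * M)) (sym (sumUpTo-suc (m (suc e)) N)) (s≤s (begin
  sumUpTo (m (suc e) ∘ suc) N                ≤⟨ sum-map-≤ (upTo (suc N)) (λ i∈ → m-monotone e (s≤s z≤n) (∈-upTo⁻ i∈)) ⟩
  sumUpTo (λ _ → M) N                        ≡⟨ sum-map-const M (upTo (suc N)) ⟩
  length (upTo (suc N)) * M                  ≡⟨ cong (_* M) (length-upTo (suc N)) ⟩
  suc N * M                                  ∎))
  where
  open ≤-Reasoning
  M : ℕ
  M = m (suc e) (suc N)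

mainTheorem3 : ∀ (d n : ℕ) → 1 ≤ d → 1 ≤ n →
    (p̃ d n ≤ m̃ d (d * n ∸ d + 1))
    × (p d n ≤ (d * n ∸ d + 1) * m d (d * n ∸ d + 1))
mainTheorem3 (suc e) (suc k) _ _ =
  -- `≤-pred` cancels the empty partition against the coefficient `m (suc e) 0`, which is 1.
  p̃≤m̃ e k , ≤-pred (≤-trans (p<p̃ (suc e) k) (≤-trans (p̃≤m̃ e k)
    (m̃≤1+N*m e (suc e * suc k ∸ suc e + 1))))
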